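{- Let $A$ be a finite set with $|A|\ge2$ and let $n\ge2$. Any transformation $f$ of $A^n$ can be computed with $n-1$ memory cells and no more than $2n-1$ instructions: $\mathcal{L}(f|n-1)\le 2n-1$.
   Context: For $N\ge1$, a transformation of $A^N$ is a map $h=(h_1,\dots,h_N):A^N\to A^N$; its coordinate function $h_i:A^N\to A$ is trivial if $h_i(x)=x_i$ for all $x$. An instruction of $A^N$ is a transformation of $A^N$ with at most one nontrivial coordinate function. A program of length $L$ computing $h$ is a sequence of instructions $g^1,\dots,g^L$ of $A^N$ with $h=g^L\circ\cdots\circ g^1$. The procedural complexity $\mathcal{L}(h)$ is the shortest length of a program computing $h$; the identity has procedural complexity $0$. For a transformation $f$ of $A^n$, $D(f,m)$ is the set of transformations $h$ of $A^{n+m}$ such that $h_i(x_1,\dots,x_{n+m})=f_i(x_1,\dots,x_n)$ for all $1\le i\le n$ and all $(x_1,\dots,x_{n+m})\in A^{n+m}$. The shortest length of a program computing $f$ using $m$ memory cells is $\mathcal{L}(f|m):=\min_{h\in D(f,m)}\mathcal{L}(h)$. -}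

module Defs where

open import Data.Fin.Base using (Fin; _↑ˡ_)
open import Data.Nat.Base using (ℕ; _+_; _≤_)
open import Data.Product.Base using (Σ-syntax; ∃-syntax; _×_; proj₁)
open import Data.Vec.Base using (Vec; []; _∷_; lookup; take)
open import Function.Base using (id; _∘_)
open import Level using (Level)
open import Relation.Binary.PropositionalEquality.Core using (_≡_; _≗_)
open import Relation.Nullary.Negation.Core using (¬_)

private
  variable
    a ℓ : Level
    A : Set a
    L n N : ℕ

Transformation : Set a → ℕ → Set a
Transformation A N = Vec A N → Vec A N

coordinate : Transformation A N → Fin N → Vec A N → A
coordinate h i x = lookup (h x) i

Trivial : Transformation A N → Fin N → Set _
Trivial h i = ∀ x → coordinate h i x ≡ lookup x i

IsInstruction : Transformation A N → Set _
IsInstruction h = ∀ i j → ¬ Trivial h i → ¬ Trivial h j → i ≡ j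

Instruction : Set a → ℕ → Set a
Instruction A N = Σ[ g ∈ Transformation A N ] IsInstruction g

Program : Set a → ℕ → ℕ → Set a
Program A N L = Vec (Instruction A N) L

-- The head of the vector is executed first: ⟦ g¹ ∷ … ∷ gᴸ ∷ [] ⟧ = gᴸ ∘ ⋯ ∘ g¹.
⟦_⟧ : Program A N L → Transformation A N
⟦ [] ⟧     = id
⟦ g ∷ gs ⟧ = ⟦ gs ⟧ ∘ proj₁ g

-- Transformations are compared pointwise, as function extensionality is
-- not available.
_Computes_ : Program A N L → Transformation A N → Set _
p Computes h = h ≗ ⟦ p ⟧

IsMinimum : (ℕ → Set ℓ) → ℕ → Set ℓ
IsMinimum P k = P k × (∀ j → P j → k ≤ j)

-- The complexities are given by their graphs: as total functions they would
-- require a proof that the minima exist.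

-- ℒ(h) = L
ProceduralComplexity : Transformation A N → ℕ → Set _
ProceduralComplexity {A = A} {N = N} h =
  IsMinimum (λ L → Σ[ p ∈ Program A N L ] p Computes h)

-- h ∈ D(f, m)
D : Transformation A n → (m : ℕ) → Transformation A (n + m) → Set _
D {n = n} f m h =
  ∀ i x → coordinate h (i ↑ˡ m) x ≡ coordinate f i (take n x)

-- ℒ(f|m) = L
MemoryComplexity : Transformation A n → ℕ → ℕ → Set _
MemoryComplexity f m =
  IsMinimum (λ L → ∃[ h ] (D f m h × ProceduralComplexity h L))

{-# OPTIONS --safe #-}

-- Copy the first n − 1 registers to the memory cells, then overwrite the
-- registers 1, …, n in order: the old values of the first n − 1 registers are
-- read from the memory, and the last register is overwritten last.  This takes
-- (n − 1) + n instructions.  Constructively, the minimum ℒ(f|n−1) also has to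
-- be shown to exist, which is done by exhaustive search over programs: a
-- transformation of a finite set is determined up to ≗ by its table.
module Submission where

open import Data.Fin.Base
  using (Fin; zero; suc; fromℕ; inject₁; _<_; _↑ˡ_; _↑ʳ_; splitAt; funToFin; finToFun)
open import Data.Fin.Properties
  using (_≟_; all?; any?; finToFun-funToFin; inj⇒≟; suc-injective; <⇒≢;
         ↑ˡ-injective; ↑ʳ-injective; splitAt-↑ˡ; splitAt-↑ʳ; ≤fromℕ)
open import Data.Fin.Relation.Unary.Top using (view; ‵fromℕ; ‵inject₁)
open import Data.Nat.Base
  using (ℕ; zero; suc; _+_; _*_; _∸_; _^_; _≤_; z≤n; s≤s; z<s; s<s)
open import Data.Nat.Properties using (≤-reflexive; ≤-trans; <-≤-trans; +-identityʳ)
open import Data.Product.Base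
  using (Σ-syntax; ∃; ∃-syntax; _×_; _,_; proj₁)
open import Data.Vec.Base
  using (Vec; []; _∷_; _++_; lookup; tabulate; take; _[_]≔_)
open import Data.Vec.Properties
  using (lookup∘update; lookup∘update′; tabulate∘lookup; tabulate-cong)
open import Function.Base using (id; _∘_)
open import Function.Bundles using (_↔_; module Inverse)
open import Function.Properties.Inverse using (↔⇒↣)
open import Level using (Level)
open import Relation.Binary.Definitions using (DecidableEquality; _Respects_)
open import Relation.Binary.PropositionalEquality
open import Relation.Nullary.Decidable
  using (Dec; yes; no; ¬?; map′; _×-dec_; _→-dec_; decidable-stable)
open import Relation.Nullary.Negation using (contradiction)
open import Relation.Unary using (Pred; Decidable)
open import Defs

private
  variable
    a p : Level
    A : Set a
    k m n L M N : ℕ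

↑ˡ≢↑ʳ : {i : Fin m} {j : Fin n} → i ↑ˡ n ≢ m ↑ʳ j
↑ˡ≢↑ʳ {m = m} {n = n} {i} {j} eq
  with () ← trans (sym (splitAt-↑ˡ m i n)) (trans (cong (splitAt m) eq) (splitAt-↑ʳ m n j))

lookup-↑ˡ : (xs : Vec A (m + n)) (i : Fin m) → lookup xs (i ↑ˡ n) ≡ lookup (take m xs) i
lookup-↑ˡ (x ∷ xs) zero    = refl
lookup-↑ˡ (x ∷ xs) (suc i) = lookup-↑ˡ xs i

-- Upward search from 0: the known witness bounds the recursion, which shifts the predicate by one.
minimum : {P : Pred ℕ p} → Decidable P → P n → ∃[ k ] (IsMinimum P k × k ≤ n)
minimum {n = zero} P? pn = 0 , (pn , λ _ _ → z≤n) , z≤n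
minimum {n = suc n} P? pn with P? 0
... | yes p0 = 0 , (p0 , λ _ _ → z≤n) , z≤n
... | no ¬p0 with minimum (P? ∘ suc) pn
...   | k , (pk , k-min) , k≤n = suc k , (pk , below) , s≤s k≤n
  where
  below : ∀ j → _ → suc k ≤ j
  below zero    p0 = contradiction p0 ¬p0
  below (suc j) pj = s≤s (k-min j pj)

Trivial-resp-≗ : {g h : Transformation A N} → g ≗ h → ∀ {i} → Trivial g i → Trivial h i
Trivial-resp-≗ g≗h t x = trans (cong (λ y → lookup y _) (sym (g≗h x))) (t x)

IsInstruction-resp-≗ : IsInstruction {A = A} {N = N} Respects _≗_
IsInstruction-resp-≗ g≗h ins i j ¬hᵢ ¬hⱼ =
  ins i j (¬hᵢ ∘ Trivial-resp-≗ g≗h) (¬hⱼ ∘ Trivial-resp-≗ g≗h)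

D-resp-≗ : {f : Transformation A n} → D f m Respects _≗_
D-resp-≗ g≗h d i x = trans (cong (λ y → lookup y _) (sym (g≗h x))) (d i x)

⟦++⟧ : (gs : Program A N L) (hs : Program A N M) → ⟦ gs ++ hs ⟧ ≗ ⟦ hs ⟧ ∘ ⟦ gs ⟧
⟦++⟧ []       hs x = refl
⟦++⟧ (g ∷ gs) hs x = ⟦++⟧ gs hs (proj₁ g x)

module ExhaustiveSearch {A : Set a} {q : ℕ} (A↔Fin : A ↔ Fin q) where
  open Inverse A↔Fin

  _≟ᴬ_ : DecidableEquality A
  _≟ᴬ_ = inj⇒≟ (↔⇒↣ A↔Fin)

  encode : Vec A N → Fin (q ^ N)
  encode xs = funToFin (to ∘ lookup xs)

  decode : Fin (q ^ N) → Vec A N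
  decode i = tabulate (from ∘ finToFun i)

  decode-encode : (xs : Vec A N) → decode (encode xs) ≡ xs
  decode-encode xs = trans
    (tabulate-cong λ i → inverseʳ (finToFun-funToFin (to ∘ lookup xs) i))
    (tabulate∘lookup xs)

  allVec? : {P : Pred (Vec A N) p} → Decidable P → Dec (∀ xs → P xs)
  allVec? {P = P} P? = map′
    (λ ∀P xs → subst P (decode-encode xs) (∀P (encode xs)))
    (_∘ decode)
    (all? (P? ∘ decode))

  fromTable : Fin ((q ^ N) ^ (q ^ N)) → Transformation A N
  fromTable t = decode ∘ finToFun t ∘ encode

  table : Transformation A N → Fin ((q ^ N) ^ (q ^ N))
  table h = funToFin (encode ∘ h ∘ decode)

  fromTable-table : (h : Transformation A N) → fromTable (table h) ≗ h
  fromTable-table h x = begin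
    decode (finToFun (table h) (encode x))  ≡⟨ cong decode (finToFun-funToFin _ (encode x)) ⟩
    decode (encode (h (decode (encode x)))) ≡⟨ decode-encode _ ⟩
    h (decode (encode x))                   ≡⟨ cong h (decode-encode x) ⟩
    h x                                     ∎
    where open ≡-Reasoning

  -- A transformation is recovered from its table only up to `≗`, so invariance of `P` under `≗` is
  -- what makes the search over the finitely many tables exhaustive.
  anyTransformation? : {P : Pred (Transformation A N) p} →
    Decidable P → P Respects _≗_ → Dec (∃ P)
  anyTransformation? P? resp = map′
    (λ (t , Pt) → fromTable t , Pt)
    (λ (h , Ph) → table h , resp (sym ∘ fromTable-table h) Ph)
    (any? (P? ∘ fromTable))

  isInstruction? : Decidable (IsInstruction {A = A} {N = N})
  isInstruction? h = all? λ i → all? λ j →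
    ¬? (trivial? i) →-dec ¬? (trivial? j) →-dec i ≟ j
    where
    trivial? : Decidable (Trivial h)
    trivial? i = allVec? λ x → lookup (h x) i ≟ᴬ lookup x i

  D? : (f : Transformation A n) (m : ℕ) → Decidable (D f m)
  D? {n = n} f m h = all? λ i → allVec? λ x →
    coordinate h (i ↑ˡ m) x ≟ᴬ coordinate f i (take n x)

  -- `P` is kept general so that the recursion can absorb the first instruction `g`: the remaining
  -- ones are searched for the predicate `P (h ∘ g)` of `h`.
  anyProgram? : ∀ L {P : Pred (Transformation A N) p} → Decidable P → P Respects _≗_ →
    Dec (Σ[ gs ∈ Program A N L ] P ⟦ gs ⟧)
  anyProgram? zero P? resp = map′ ([] ,_) (λ { ([] , Pid) → Pid }) (P? id)
  anyProgram? (suc L) P? resp = map′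
    (λ (g , ins , gs , Pgs) → (g , ins) ∷ gs , Pgs)
    (λ { ((g , ins) ∷ gs , Pgs) → g , ins , gs , Pgs })
    (anyTransformation?
      (λ g → isInstruction? g ×-dec anyProgram? L (λ h → P? (h ∘ g)) (λ h≗h′ → resp (h≗h′ ∘ g)))
      (λ g≗g′ (ins , gs , Pgs) →
        IsInstruction-resp-≗ g≗g′ ins , gs , resp (cong ⟦ gs ⟧ ∘ g≗g′) Pgs))

  -- The two nested minima collapse into one: the least length of a program whose denotation lies in
  -- `D f m`.
  memoryComplexity-≤ : {f : Transformation A n} (gs : Program A (n + m) L) → D f m ⟦ gs ⟧ →
    ∃[ l ] (MemoryComplexity f m l × l ≤ L)
  memoryComplexity-≤ {m = m} {f = f} gs d
    with minimum (λ l → anyProgram? l (D? f m) (D-resp-≗ {f = f})) (gs , d)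
  ... | l , ((hs , dₕ) , l-min) , l≤L =
    -- `l` is also the procedural complexity of `⟦ hs ⟧`, since every program computing `⟦ hs ⟧` has
    -- its own denotation in `D f m`.
    l , ((⟦ hs ⟧ , dₕ , (hs , λ _ → refl) , λ j (ks , ks≗) → l-min j (ks , D-resp-≗ {f = f} ks≗ dₕ))
        , λ j (h , d′ , (ks , ks≗) , _) → l-min j (ks , D-resp-≗ {f = f} ks≗ d′))
      , l≤L

assign : Fin N → (Vec A N → A) → Instruction A N
assign t v = (λ x → x [ t ]≔ v x) , λ i j ¬tᵢ ¬tⱼ → trans (target i ¬tᵢ) (sym (target j ¬tⱼ))
  where
  target : ∀ i → _ → i ≡ t
  -- Only the negation of triviality is given, so the equality is proved by contradiction, which is
  -- sound because equality on `Fin` is decidable.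
  target i ¬tᵢ = decidable-stable (i ≟ t) λ i≢t → ¬tᵢ λ x → lookup∘update′ i≢t x (v x)

assignAll : (Fin k → Fin N) → (Fin k → Vec A N → A) → Program A N k
assignAll t v = tabulate λ i → assign (t i) (v i)

assignAll-other : (t : Fin k → Fin N) (v : Fin k → Vec A N → A) {j : Fin N} →
  (∀ i → j ≢ t i) → ∀ x → lookup (⟦ assignAll t v ⟧ x) j ≡ lookup x j
assignAll-other {k = zero}  t v j≢t x = refl
assignAll-other {k = suc k} t v j≢t x = trans
  (assignAll-other (t ∘ suc) (v ∘ suc) (j≢t ∘ suc) _)
  (lookup∘update′ (j≢t zero) x _)

-- Each `v j` is evaluated in the state left by the earlier assignments. Independence from the
-- earlier targets moves that evaluation back to `x`, and injectivity of `t` keeps later assignments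
-- from destroying the result.
assignAll-target : (t : Fin k → Fin N) (v : Fin k → Vec A N → A) →
  (∀ {i j} → t i ≡ t j → i ≡ j) →
  (∀ {i j} → i < j → ∀ x y → v j (x [ t i ]≔ y) ≡ v j x) →
  ∀ i x → lookup (⟦ assignAll t v ⟧ x) (t i) ≡ v i x
assignAll-target {k = suc k} t v inj indep zero x = trans
  (assignAll-other (t ∘ suc) (v ∘ suc) (λ i eq → contradiction (inj eq) λ ()) _)
  (lookup∘update (t zero) x _)
assignAll-target {k = suc k} t v inj indep (suc i) x = trans
  (assignAll-target (t ∘ suc) (v ∘ suc) (suc-injective ∘ inj) (indep ∘ s<s) i _)
  (indep z<s x _)

module _ {A : Set a} {k : ℕ} where

  State : Set a
  State = Vec A (suc k + k)

  register : Fin (suc k) → Fin (suc k + k)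
  register i = i ↑ˡ k

  cell : Fin k → Fin (suc k + k)
  cell j = suc k ↑ʳ j

  save : Program A (suc k + k) k
  save = assignAll cell (λ j x → lookup x (register (inject₁ j)))

  -- Where the original value of a register is found after `save`.
  saved : Fin (suc k) → Fin (suc k + k)
  saved i with view i
  ... | ‵fromℕ     = register (fromℕ k)
  ... | ‵inject₁ j = cell j

  original : State → Vec A (suc k)
  original x = tabulate (lookup x ∘ saved)

  overwrite : Transformation A (suc k) → Program A (suc k + k) (suc k)
  overwrite f = assignAll register (λ i x → lookup (f (original x)) i)

  lookup-saved : ∀ x i → lookup (⟦ save ⟧ x) (saved i) ≡ lookup x (register i)
  lookup-saved x i with view i
  ... | ‵fromℕ     = assignAll-other cell _ (λ _ → ↑ˡ≢↑ʳ) x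
  ... | ‵inject₁ j = assignAll-target cell _ (↑ʳ-injective (suc k) _ _)
    -- Copying reads registers and writes cells, so no copy disturbs a later one.
    (λ {_} {j′} _ y _ → lookup∘update′ (↑ˡ≢↑ʳ {i = inject₁ j′}) y _) j x

  original-save : ∀ x → original (⟦ save ⟧ x) ≡ take (suc k) x
  original-save x = trans
    (tabulate-cong λ i → trans (lookup-saved x i) (lookup-↑ˡ x i))
    (tabulate∘lookup _)

  -- Here the order of overwriting matters: since `i < j`, register `i` is not the last one, and the
  -- last is the only register among the values of `saved`; the others are cells.
  saved≢register : ∀ {i j : Fin (suc k)} → i < j → ∀ l → saved l ≢ register i
  saved≢register {i} {j} i<j l eq with view l
  ... | ‵fromℕ     = <⇒≢ (<-≤-trans i<j (≤fromℕ j)) (sym (↑ˡ-injective k _ _ eq))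
  ... | ‵inject₁ _ = ↑ˡ≢↑ʳ (sym eq)

  overwrite-save : (f : Transformation A (suc k)) → D f k ⟦ save ++ overwrite f ⟧
  overwrite-save f i x = begin
    lookup (⟦ save ++ overwrite f ⟧ x) (register i)
      ≡⟨ cong (λ y → lookup y (register i)) (⟦++⟧ save (overwrite f) x) ⟩
    lookup (⟦ overwrite f ⟧ (⟦ save ⟧ x)) (register i)
      ≡⟨ assignAll-target register _ (↑ˡ-injective k _ _) unaffected i (⟦ save ⟧ x) ⟩
    lookup (f (original (⟦ save ⟧ x))) i
      ≡⟨ cong (λ y → lookup (f y) i) (original-save x) ⟩
    lookup (f (take (suc k) x)) i ∎
    where
    open ≡-Reasoning
    -- The value written to register `j` sees the state only through the positions `saved l`, none
    -- of which is an earlier register.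
    unaffected : ∀ {i j} → i < j → ∀ x y →
      lookup (f (original (x [ register i ]≔ y))) j ≡ lookup (f (original x)) j
    unaffected {j = j} i<j x y = cong (λ z → lookup (f z) j)
      (tabulate-cong λ l → lookup∘update′ (saved≢register i<j l) x y)

proposition12 : ∀ {a : Level} {A : Set a} {q : ℕ} → A ↔ Fin q → 2 ≤ q →
    ∀ (n : ℕ) → 2 ≤ n → (f : Transformation A n) →
    ∃[ L ] (MemoryComplexity f (n ∸ 1) L × L ≤ 2 * n ∸ 1)
proposition12 A↔Fin _ (suc k) _ f
  with L , ℒ≡L , L≤ ← ExhaustiveSearch.memoryComplexity-≤ A↔Fin {f = f} (save ++ overwrite f) (overwrite-save f)
  -- The program has length `k + suc k`, whereas `2 * suc k ∸ 1` reduces to `k + (suc k + 0)`.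
  = L , ℒ≡L , ≤-trans L≤ (≤-reflexive (cong (k +_) (sym (+-identityʳ (suc k)))))
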